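{- Let $\mathcal R$ be a polarized rewrite system such that $\longrightarrow_{ - }$ and $\longrightarrow_{+}$ commute and that has a pre-model, and fix such a pre-model of $\mathcal R$. Then every proof-term $\pi$ of $\Gamma \vdash_{\mathcal R} A$ belongs to $|A|$, and hence is strongly normalizable.
   Context: Propositions are built from atomic propositions (propositional symbols) and the constant $\bot$ using the binary connectives $\Rightarrow$, $\wedge$, $\vee$. A rewrite rule is a pair $P \longrightarrow A$ with $P$ an atomic proposition and $A$ an arbitrary proposition. A polarized rewrite system $\mathcal R = \langle \mathcal R_{ - }, \mathcal R_{+}\rangle$ is a pair of sets of rewrite rules; rules of $\mathcal R_{ - }$ are called negative, those of $\mathcal R_{+}$ positive. The one-step relations $\longrightarrow^1_{ - }$, $\longrightarrow^1_{+}$ are the least relations on propositions such that: $P \longrightarrow^1_{ - } A$ for every negative rule $P \longrightarrow A$; $P \longrightarrow^1_{+} A$ for every positive rule $P\longrightarrow A$; $A \Rightarrow B \longrightarrow^1_{ - } A' \Rightarrow B$ if $A \longrightarrow^1_{+} A'$, and $A \Rightarrow B \longrightarrow^1_{ - } A \Rightarrow B'$ if $B \longrightarrow^1_{ - } B'$; $A \Rightarrow B \longrightarrow^1_{+} A' \Rightarrow B$ if $A \longrightarrow^1_{ - } A'$, and $A \Rightarrow B \longrightarrow^1_{+} A \Rightarrow B'$ if $B \longrightarrow^1_{+} B'$; for $\circ \in \{\wedge, \vee\}$ and $s \in \{ -,+\}$, $A \circ B \longrightarrow^1_{s} A' \circ B$ if $A \longrightarrow^1_{s} A'$, and $A \circ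 B \longrightarrow^1_{s} A \circ B'$ if $B \longrightarrow^1_{s} B'$. The relations $\longrightarrow_{ - }$, $\longrightarrow_{+}$ are the reflexive-transitive closures of $\longrightarrow^1_{ - }$, $\longrightarrow^1_{+}$; $B \longleftarrow_{s} A$ means $A \longrightarrow_{s} B$. They commute if whenever $A \longleftarrow_{ - } B \longrightarrow_{+} C$ there is $D$ with $A \longrightarrow_{+} D \longleftarrow_{ - } C$. Proof-terms: $\pi ::= \alpha \mid \lambda\alpha\,\pi \mid (\pi_1\,\pi_2) \mid \langle \pi_1,\pi_2\rangle \mid \mathit{fst}(\pi) \mid \mathit{snd}(\pi) \mid i(\pi) \mid j(\pi) \mid \delta(\pi_1, \alpha\pi_2, \beta\pi_3) \mid \delta_\bot(\pi)$, with $\alpha,\beta$ proof variables ($\lambda\alpha$ binds $\alpha$; in $\delta(\pi_1,\alpha\pi_2,\beta\pi_3)$, $\alpha$ is bound in $\pi_2$ and $\beta$ in $\pi_3$). A context $\Gamma$ is a finite set of declarations $\alpha:B$ of distinct proof variables. "$\pi$ is a proof-term of $\Gamma \vdash_{\mathcal R} A$" is defined inductively: (axiom) $\alpha$ is one of $\Gamma \vdash_{\mathcal R} A$ if $\alpha:B \in \Gamma$ and $B \longrightarrow_{ - } C \longleftarrow_{+} A$ for some $C$; ($\Rightarrow$-intro) if $\pi$ is one of $\Gamma, \alpha:A \vdash_{\mathcal R} B$ and $C \longrightarrow_{+} (A \Rightarrow B)$ then $\lambda\alpha\,\pi$ is one of $\Gamma \vdash_{\mathcal R} C$; ($\Rightarrow$-elim)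 if $\pi_1$ is one of $\Gamma\vdash_{\mathcal R} C$ with $C \longrightarrow_{ - } (A \Rightarrow B)$ and $\pi_2$ one of $\Gamma \vdash_{\mathcal R} A$, then $(\pi_1\,\pi_2)$ is one of $\Gamma \vdash_{\mathcal R} B$; ($\wedge$-intro) if $\pi_1$ is one of $\Gamma \vdash_{\mathcal R} A$, $\pi_2$ one of $\Gamma\vdash_{\mathcal R} B$ and $C \longrightarrow_{+} (A\wedge B)$, then $\langle\pi_1,\pi_2\rangle$ is one of $\Gamma \vdash_{\mathcal R} C$; ($\wedge$-elim) if $\pi$ is one of $\Gamma \vdash_{\mathcal R} C$ and $C \longrightarrow_{ - } (A \wedge B)$ then $\mathit{fst}(\pi)$ is one of $\Gamma\vdash_{\mathcal R} A$ and $\mathit{snd}(\pi)$ one of $\Gamma \vdash_{\mathcal R} B$; ($\vee$-intro) if $\pi$ is one of $\Gamma\vdash_{\mathcal R} A$ (resp. $\Gamma \vdash_{\mathcal R} B$) and $C \longrightarrow_{+} (A \vee B)$ then $i(\pi)$ (resp. $j(\pi)$) is one of $\Gamma \vdash_{\mathcal R} C$; ($\vee$-elim) if $\pi_1$ is one of $\Gamma\vdash_{\mathcal R} D$ with $D \longrightarrow_{ - } (A\vee B)$, $\pi_2$ one of $\Gamma,\alpha:A \vdash_{\mathcal R} C$ and $\pi_3$ one of $\Gamma,\beta:B\vdash_{\mathcal R} C$, then $\delta(\pi_1,\alpha\pi_2,\beta\pi_3)$ is one of $\Gamma \vdash_{\mathcal R} C$; ($\bot$-elim) if $\pi$ is one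 of $\Gamma \vdash_{\mathcal R} B$ with $B \longrightarrow_{ - } \bot$ then $\delta_\bot(\pi)$ is one of $\Gamma \vdash_{\mathcal R} A$ for every $A$. Proof reduction: $\triangleright^1$ is the closure under all term contexts of $(\lambda\alpha\,\pi_1\;\pi_2) \triangleright [\pi_2/\alpha]\pi_1$, $\mathit{fst}(\langle\pi_1,\pi_2\rangle) \triangleright \pi_1$, $\mathit{snd}(\langle\pi_1,\pi_2\rangle)\triangleright \pi_2$, $\delta(i(\pi_1),\alpha\pi_2,\beta\pi_3)\triangleright[\pi_1/\alpha]\pi_2$, $\delta(j(\pi_1),\alpha\pi_2,\beta\pi_3)\triangleright[\pi_1/\beta]\pi_3$ (capture-avoiding substitution); $\triangleright$ is its reflexive-transitive closure ("$\pi$ reduces to $\pi'$"). A proof-term is strongly normalizable if there is no infinite $\triangleright^1$-sequence from it. A proof-term is neutral if it is a variable or of the form $(\pi_1\,\pi_2)$, $\mathit{fst}(\pi)$, $\mathit{snd}(\pi)$, $\delta(\pi_1,\alpha\pi_2,\beta\pi_3)$ or $\delta_\bot(\pi)$. A set $R$ of proof-terms is a reducibility candidate if: every element is strongly normalizable; $\pi\in R$ and $\pi\triangleright\pi'$ imply $\pi'\in R$; if $\pi$ is neutral and every $\pi'$ with $\pi\triangleright^1\pi'$ is in $R$ then $\pi\in R$. A pre-model assigns a reducibility candidate $\hat P$ to each atomic $P$. Then $|P| = \hat P$; $\pi \in |A \Rightarrow B|$ iff $\pi$ is strongly normalizable and whenever $\pi$ reduces to $\lambda\alpha\,\pi_1$,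 $[\pi'/\alpha]\pi_1 \in |B|$ for all $\pi' \in |A|$; $\pi \in |A \wedge B|$ iff $\pi$ is strongly normalizable and whenever $\pi$ reduces to $\langle\pi_1,\pi_2\rangle$, $\pi_1\in|A|$ and $\pi_2\in|B|$; $\pi \in |A\vee B|$ iff $\pi$ is strongly normalizable and whenever $\pi$ reduces to $i(\pi_1)$ (resp. $j(\pi_2)$), $\pi_1\in|A|$ (resp. $\pi_2\in|B|$); $|\bot|$ is the set of strongly normalizable proof-terms. A pre-model of $\mathcal R$ is a pre-model with $|P|\subseteq|A|$ for each negative rule $P\longrightarrow A$ and $|A|\subseteq|P|$ for each positive rule $P\longrightarrow A$. -}

module Defs where

open import Data.Nat using (ℕ; zero; suc)
open import Data.List using (List; []; _∷_)
open import Data.Product using (∃; _×_; _,_)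
open import Relation.Binary.Construct.Closure.ReflexiveTransitive using (Star)
open import Induction.WellFounded using (Acc)

data Prop (Atom : Set) : Set where
  atom : Atom → Prop Atom
  ⊥′   : Prop Atom
  _⇒_  : Prop Atom → Prop Atom → Prop Atom
  _∧_  : Prop Atom → Prop Atom → Prop Atom
  _∨_  : Prop Atom → Prop Atom → Prop Atom

-- Polarized rewrite systems: R₋ P A means "P ⟶ A is a negative rule"

record PRS (Atom : Set) : Set₁ where
  field
    R₋ : Atom → Prop Atom → Set
    R₊ : Atom → Prop Atom → Set

data Sign : Set where
  neg pos : Sign

opposite : Sign → Sign
opposite neg = pos
opposite pos = neg

data Step {Atom : Set} (R : PRS Atom) : Sign → Prop Atom → Prop Atom → Set where
  rule₋ : ∀ {P A} → PRS.R₋ R P A → Step R neg (atom P) A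
  rule₊ : ∀ {P A} → PRS.R₊ R P A → Step R pos (atom P) A
  ⇒ˡ : ∀ {s A A′ B} → Step R (opposite s) A A′ → Step R s (A ⇒ B) (A′ ⇒ B)
  ⇒ʳ : ∀ {s A B B′} → Step R s B B′ → Step R s (A ⇒ B) (A ⇒ B′)
  ∧ˡ : ∀ {s A A′ B} → Step R s A A′ → Step R s (A ∧ B) (A′ ∧ B)
  ∧ʳ : ∀ {s A B B′} → Step R s B B′ → Step R s (A ∧ B) (A ∧ B′)
  ∨ˡ : ∀ {s A A′ B} → Step R s A A′ → Step R s (A ∨ B) (A′ ∨ B)
  ∨ʳ : ∀ {s A B B′} → Step R s B B′ → Step R s (A ∨ B) (A ∨ B′)

-- ⟶₋ is Rewrite R neg, ⟶₊ is Rewrite R pos (reflexive-transitive closures)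
Rewrite : {Atom : Set} → PRS Atom → Sign → Prop Atom → Prop Atom → Set
Rewrite R s = Star (Step R s)

Commute : {Atom : Set} → PRS Atom → Set
Commute R = ∀ {A B C} → Rewrite R neg B A → Rewrite R pos B C →
            ∃ λ D → Rewrite R pos A D × Rewrite R neg C D

-- Proof-terms (de Bruijn indices for proof variables)

data Term : Set where
  var   : ℕ → Term
  ƛ     : Term → Term
  _·_   : Term → Term → Term
  ⟨_,_⟩ : Term → Term → Term
  fst   : Term → Term
  snd   : Term → Term
  inl   : Term → Term
  inr   : Term → Term
  δ     : Term → Term → Term → Term   -- δ(π₁, α π₂, β π₃): binds index 0 in π₂ and π₃
  δ⊥    : Term → Term

ext : (ℕ → ℕ) → ℕ → ℕ
ext ρ zero    = zero
ext ρ (suc n) = suc (ρ n)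

rename : (ℕ → ℕ) → Term → Term
rename ρ (var n)     = var (ρ n)
rename ρ (ƛ t)       = ƛ (rename (ext ρ) t)
rename ρ (t · u)     = rename ρ t · rename ρ u
rename ρ ⟨ t , u ⟩   = ⟨ rename ρ t , rename ρ u ⟩
rename ρ (fst t)     = fst (rename ρ t)
rename ρ (snd t)     = snd (rename ρ t)
rename ρ (inl t)     = inl (rename ρ t)
rename ρ (inr t)     = inr (rename ρ t)
rename ρ (δ t u v)   = δ (rename ρ t) (rename (ext ρ) u) (rename (ext ρ) v)
rename ρ (δ⊥ t)      = δ⊥ (rename ρ t)

exts : (ℕ → Term) → ℕ → Term
exts σ zero    = var zero
exts σ (suc n) = rename suc (σ n)

subst : (ℕ → Term) → Term → Term
subst σ (var n)     = σ n
subst σ (ƛ t)       = ƛ (subst (exts σ) t)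
subst σ (t · u)     = subst σ t · subst σ u
subst σ ⟨ t , u ⟩   = ⟨ subst σ t , subst σ u ⟩
subst σ (fst t)     = fst (subst σ t)
subst σ (snd t)     = snd (subst σ t)
subst σ (inl t)     = inl (subst σ t)
subst σ (inr t)     = inr (subst σ t)
subst σ (δ t u v)   = δ (subst σ t) (subst (exts σ) u) (subst (exts σ) v)
subst σ (δ⊥ t)      = δ⊥ (subst σ t)

single : Term → ℕ → Term
single u zero    = u
single u (suc n) = var n

_[_] : Term → Term → Term
t [ u ] = subst (single u) t

infix 4 _▷¹_ _▷_

data _▷¹_ : Term → Term → Set where
  β-ƛ   : ∀ {t u} → (ƛ t · u) ▷¹ t [ u ]
  β-fst : ∀ {t u} → fst ⟨ t , u ⟩ ▷¹ t
  β-snd : ∀ {t u} → snd ⟨ t , u ⟩ ▷¹ u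
  β-inl : ∀ {t u v} → δ (inl t) u v ▷¹ u [ t ]
  β-inr : ∀ {t u v} → δ (inr t) u v ▷¹ v [ t ]
  ξ-ƛ    : ∀ {t t′} → t ▷¹ t′ → ƛ t ▷¹ ƛ t′
  ξ-·ˡ   : ∀ {t t′ u} → t ▷¹ t′ → t · u ▷¹ t′ · u
  ξ-·ʳ   : ∀ {t u u′} → u ▷¹ u′ → t · u ▷¹ t · u′
  ξ-⟨⟩ˡ  : ∀ {t t′ u} → t ▷¹ t′ → ⟨ t , u ⟩ ▷¹ ⟨ t′ , u ⟩
  ξ-⟨⟩ʳ  : ∀ {t u u′} → u ▷¹ u′ → ⟨ t , u ⟩ ▷¹ ⟨ t , u′ ⟩
  ξ-fst  : ∀ {t t′} → t ▷¹ t′ → fst t ▷¹ fst t′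
  ξ-snd  : ∀ {t t′} → t ▷¹ t′ → snd t ▷¹ snd t′
  ξ-inl  : ∀ {t t′} → t ▷¹ t′ → inl t ▷¹ inl t′
  ξ-inr  : ∀ {t t′} → t ▷¹ t′ → inr t ▷¹ inr t′
  ξ-δ₁   : ∀ {t t′ u v} → t ▷¹ t′ → δ t u v ▷¹ δ t′ u v
  ξ-δ₂   : ∀ {t u u′ v} → u ▷¹ u′ → δ t u v ▷¹ δ t u′ v
  ξ-δ₃   : ∀ {t u v v′} → v ▷¹ v′ → δ t u v ▷¹ δ t u v′
  ξ-δ⊥   : ∀ {t t′} → t ▷¹ t′ → δ⊥ t ▷¹ δ⊥ t′

_▷_ : Term → Term → Set
_▷_ = Star _▷¹_

_◁¹_ : Term → Term → Set
t′ ◁¹ t = t ▷¹ t′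

SN : Term → Set
SN = Acc _◁¹_

data Neutral : Term → Set where
  var : ∀ {n} → Neutral (var n)
  app : ∀ {t u} → Neutral (t · u)
  fst : ∀ {t} → Neutral (fst t)
  snd : ∀ {t} → Neutral (snd t)
  δ   : ∀ {t u v} → Neutral (δ t u v)
  δ⊥  : ∀ {t} → Neutral (δ⊥ t)

record IsCandidate (C : Term → Set) : Set where
  field
    cr₁ : ∀ {t} → C t → SN t
    cr₂ : ∀ {t t′} → C t → t ▷ t′ → C t′
    cr₃ : ∀ {t} → Neutral t → (∀ {t′} → t ▷¹ t′ → C t′) → C t

record PreModel (Atom : Set) : Set₁ where
  field
    hat       : Atom → Term → Set
    candidate : ∀ P → IsCandidate (hat P)

∣_∣ : {Atom : Set} → PreModel Atom → Prop Atom → Term → Set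
∣ M ∣ (atom P) t = PreModel.hat M P t
∣ M ∣ ⊥′ t       = SN t
∣ M ∣ (A ⇒ B) t  = SN t × (∀ {t₁} → t ▷ ƛ t₁ → ∀ u → ∣ M ∣ A u → ∣ M ∣ B (t₁ [ u ]))
∣ M ∣ (A ∧ B) t  = SN t × (∀ {t₁ t₂} → t ▷ ⟨ t₁ , t₂ ⟩ → ∣ M ∣ A t₁ × ∣ M ∣ B t₂)
∣ M ∣ (A ∨ B) t  = SN t × (∀ {t₁} → t ▷ inl t₁ → ∣ M ∣ A t₁)
                        × (∀ {t₂} → t ▷ inr t₂ → ∣ M ∣ B t₂)

IsPreModelOf : {Atom : Set} → PRS Atom → PreModel Atom → Set
IsPreModelOf R M =
  (∀ {P A} → PRS.R₋ R P A → ∀ t → ∣ M ∣ (atom P) t → ∣ M ∣ A t) ×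
  (∀ {P A} → PRS.R₊ R P A → ∀ t → ∣ M ∣ A t → ∣ M ∣ (atom P) t)

data _∋_∶_ {Atom : Set} : List (Prop Atom) → ℕ → Prop Atom → Set where
  here  : ∀ {Γ B} → (B ∷ Γ) ∋ zero ∶ B
  there : ∀ {Γ B C n} → Γ ∋ n ∶ B → (C ∷ Γ) ∋ suc n ∶ B

data _⊢[_]_∶_ {Atom : Set} (Γ : List (Prop Atom)) (R : PRS Atom) : Term → Prop Atom → Set where
  ax   : ∀ {n A B C} → Γ ∋ n ∶ B → Rewrite R neg B C → Rewrite R pos A C →
         Γ ⊢[ R ] var n ∶ A
  ⇒I   : ∀ {π A B C} → (A ∷ Γ) ⊢[ R ] π ∶ B → Rewrite R pos C (A ⇒ B) →
         Γ ⊢[ R ] ƛ π ∶ C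
  ⇒E   : ∀ {π₁ π₂ A B C} → Γ ⊢[ R ] π₁ ∶ C → Rewrite R neg C (A ⇒ B) →
         Γ ⊢[ R ] π₂ ∶ A → Γ ⊢[ R ] π₁ · π₂ ∶ B
  ∧I   : ∀ {π₁ π₂ A B C} → Γ ⊢[ R ] π₁ ∶ A → Γ ⊢[ R ] π₂ ∶ B →
         Rewrite R pos C (A ∧ B) → Γ ⊢[ R ] ⟨ π₁ , π₂ ⟩ ∶ C
  ∧E₁  : ∀ {π A B C} → Γ ⊢[ R ] π ∶ C → Rewrite R neg C (A ∧ B) →
         Γ ⊢[ R ] fst π ∶ A
  ∧E₂  : ∀ {π A B C} → Γ ⊢[ R ] π ∶ C → Rewrite R neg C (A ∧ B) →
         Γ ⊢[ R ] snd π ∶ B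
  ∨I₁  : ∀ {π A B C} → Γ ⊢[ R ] π ∶ A → Rewrite R pos C (A ∨ B) →
         Γ ⊢[ R ] inl π ∶ C
  ∨I₂  : ∀ {π A B C} → Γ ⊢[ R ] π ∶ B → Rewrite R pos C (A ∨ B) →
         Γ ⊢[ R ] inr π ∶ C
  ∨E   : ∀ {π₁ π₂ π₃ A B C D} → Γ ⊢[ R ] π₁ ∶ D → Rewrite R neg D (A ∨ B) →
         (A ∷ Γ) ⊢[ R ] π₂ ∶ C → (B ∷ Γ) ⊢[ R ] π₃ ∶ C →
         Γ ⊢[ R ] δ π₁ π₂ π₃ ∶ C
  ⊥E   : ∀ {π A B} → Γ ⊢[ R ] π ∶ B → Rewrite R neg B ⊥′ →
         Γ ⊢[ R ] δ⊥ π ∶ A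

-- Tait–Girard reducibility.  Each |A| is a reducibility candidate, and the
-- pre-model conditions make |_| monotone along ⟶₋ and antitone along ⟶₊
-- (the variance flipping to the left of ⇒ matches the sign flip of ⟶¹), so a
-- rewrite C ⟶₋ A ⇒ B in an elimination gives |C| ⊆ |A ⇒ B|, and dually for
-- introductions and axioms.  By induction on derivations, substituting
-- reducible terms for the free variables of a proof-term yields a reducible
-- term; variables are neutral and normal, hence reducible, so the identity
-- substitution applies.
module Submission where

open import Defs
open import Data.Nat using (ℕ; zero; suc)
open import Data.List using (List; _∷_)
open import Data.Product using (∃; _×_; _,_; proj₁; proj₂)
open import Function using (id; _∘_)
open import Relation.Nullary using (¬_; contradiction)
open import Relation.Unary using (_⊆_)
open import Relation.Binary.PropositionalEquality as Eq
  using (_≡_; _≗_; refl; sym; trans; cong; cong₂)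
open import Relation.Binary.Construct.Closure.ReflexiveTransitive
  using (ε; _◅_; _◅◅_; gmap)
open import Induction.WellFounded using (acc; acc-inverse)

cong₃ : ∀ {A B C D : Set} (f : A → B → C → D) {a a′ b b′ c c′} →
        a ≡ a′ → b ≡ b′ → c ≡ c′ → f a b c ≡ f a′ b′ c′
cong₃ f refl refl refl = refl

-- Renaming and substitution

ext-cong : ∀ {ρ ρ′} → ρ ≗ ρ′ → ext ρ ≗ ext ρ′
ext-cong eq zero    = refl
ext-cong eq (suc n) = cong suc (eq n)

ext-∘ : ∀ ρ ρ′ → ext ρ ∘ ext ρ′ ≗ ext (ρ ∘ ρ′)
ext-∘ ρ ρ′ zero    = refl
ext-∘ ρ ρ′ (suc n) = refl

rename-cong : ∀ {ρ ρ′} → ρ ≗ ρ′ → rename ρ ≗ rename ρ′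
rename-cong eq (var n)   = cong var (eq n)
rename-cong eq (ƛ t)     = cong ƛ (rename-cong (ext-cong eq) t)
rename-cong eq (t · u)   = cong₂ _·_ (rename-cong eq t) (rename-cong eq u)
rename-cong eq ⟨ t , u ⟩ = cong₂ ⟨_,_⟩ (rename-cong eq t) (rename-cong eq u)
rename-cong eq (fst t)   = cong fst (rename-cong eq t)
rename-cong eq (snd t)   = cong snd (rename-cong eq t)
rename-cong eq (inl t)   = cong inl (rename-cong eq t)
rename-cong eq (inr t)   = cong inr (rename-cong eq t)
rename-cong eq (δ t u v) =
  cong₃ δ (rename-cong eq t) (rename-cong (ext-cong eq) u) (rename-cong (ext-cong eq) v)
rename-cong eq (δ⊥ t)    = cong δ⊥ (rename-cong eq t)

rename-∘ : ∀ ρ ρ′ → rename ρ ∘ rename ρ′ ≗ rename (ρ ∘ ρ′)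
rename-∘ ρ ρ′ (var n)   = refl
rename-∘ ρ ρ′ (ƛ t)     =
  cong ƛ (trans (rename-∘ (ext ρ) (ext ρ′) t) (rename-cong (ext-∘ ρ ρ′) t))
rename-∘ ρ ρ′ (t · u)   = cong₂ _·_ (rename-∘ ρ ρ′ t) (rename-∘ ρ ρ′ u)
rename-∘ ρ ρ′ ⟨ t , u ⟩ = cong₂ ⟨_,_⟩ (rename-∘ ρ ρ′ t) (rename-∘ ρ ρ′ u)
rename-∘ ρ ρ′ (fst t)   = cong fst (rename-∘ ρ ρ′ t)
rename-∘ ρ ρ′ (snd t)   = cong snd (rename-∘ ρ ρ′ t)
rename-∘ ρ ρ′ (inl t)   = cong inl (rename-∘ ρ ρ′ t)
rename-∘ ρ ρ′ (inr t)   = cong inr (rename-∘ ρ ρ′ t)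
rename-∘ ρ ρ′ (δ t u v) = cong₃ δ (rename-∘ ρ ρ′ t)
  (trans (rename-∘ (ext ρ) (ext ρ′) u) (rename-cong (ext-∘ ρ ρ′) u))
  (trans (rename-∘ (ext ρ) (ext ρ′) v) (rename-cong (ext-∘ ρ ρ′) v))
rename-∘ ρ ρ′ (δ⊥ t)    = cong δ⊥ (rename-∘ ρ ρ′ t)

exts-cong : ∀ {σ σ′} → σ ≗ σ′ → exts σ ≗ exts σ′
exts-cong eq zero    = refl
exts-cong eq (suc n) = cong (rename suc) (eq n)

subst-cong : ∀ {σ σ′} → σ ≗ σ′ → subst σ ≗ subst σ′
subst-cong eq (var n)   = eq n
subst-cong eq (ƛ t)     = cong ƛ (subst-cong (exts-cong eq) t)
subst-cong eq (t · u)   = cong₂ _·_ (subst-cong eq t) (subst-cong eq u)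
subst-cong eq ⟨ t , u ⟩ = cong₂ ⟨_,_⟩ (subst-cong eq t) (subst-cong eq u)
subst-cong eq (fst t)   = cong fst (subst-cong eq t)
subst-cong eq (snd t)   = cong snd (subst-cong eq t)
subst-cong eq (inl t)   = cong inl (subst-cong eq t)
subst-cong eq (inr t)   = cong inr (subst-cong eq t)
subst-cong eq (δ t u v) =
  cong₃ δ (subst-cong eq t) (subst-cong (exts-cong eq) u) (subst-cong (exts-cong eq) v)
subst-cong eq (δ⊥ t)    = cong δ⊥ (subst-cong eq t)

exts-ext : ∀ σ ρ → exts σ ∘ ext ρ ≗ exts (σ ∘ ρ)
exts-ext σ ρ zero    = refl
exts-ext σ ρ (suc n) = refl

subst-rename : ∀ σ ρ → subst σ ∘ rename ρ ≗ subst (σ ∘ ρ)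
subst-rename σ ρ (var n)   = refl
subst-rename σ ρ (ƛ t)     =
  cong ƛ (trans (subst-rename (exts σ) (ext ρ) t) (subst-cong (exts-ext σ ρ) t))
subst-rename σ ρ (t · u)   = cong₂ _·_ (subst-rename σ ρ t) (subst-rename σ ρ u)
subst-rename σ ρ ⟨ t , u ⟩ = cong₂ ⟨_,_⟩ (subst-rename σ ρ t) (subst-rename σ ρ u)
subst-rename σ ρ (fst t)   = cong fst (subst-rename σ ρ t)
subst-rename σ ρ (snd t)   = cong snd (subst-rename σ ρ t)
subst-rename σ ρ (inl t)   = cong inl (subst-rename σ ρ t)
subst-rename σ ρ (inr t)   = cong inr (subst-rename σ ρ t)
subst-rename σ ρ (δ t u v) = cong₃ δ (subst-rename σ ρ t)
  (trans (subst-rename (exts σ) (ext ρ) u) (subst-cong (exts-ext σ ρ) u))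
  (trans (subst-rename (exts σ) (ext ρ) v) (subst-cong (exts-ext σ ρ) v))
subst-rename σ ρ (δ⊥ t)    = cong δ⊥ (subst-rename σ ρ t)

rename-exts : ∀ ρ σ → rename (ext ρ) ∘ exts σ ≗ exts (rename ρ ∘ σ)
rename-exts ρ σ zero    = refl
rename-exts ρ σ (suc n) = trans (rename-∘ (ext ρ) suc (σ n)) (sym (rename-∘ suc ρ (σ n)))

rename-subst : ∀ ρ σ → rename ρ ∘ subst σ ≗ subst (rename ρ ∘ σ)
rename-subst ρ σ (var n)   = refl
rename-subst ρ σ (ƛ t)     =
  cong ƛ (trans (rename-subst (ext ρ) (exts σ) t) (subst-cong (rename-exts ρ σ) t))
rename-subst ρ σ (t · u)   = cong₂ _·_ (rename-subst ρ σ t) (rename-subst ρ σ u)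
rename-subst ρ σ ⟨ t , u ⟩ = cong₂ ⟨_,_⟩ (rename-subst ρ σ t) (rename-subst ρ σ u)
rename-subst ρ σ (fst t)   = cong fst (rename-subst ρ σ t)
rename-subst ρ σ (snd t)   = cong snd (rename-subst ρ σ t)
rename-subst ρ σ (inl t)   = cong inl (rename-subst ρ σ t)
rename-subst ρ σ (inr t)   = cong inr (rename-subst ρ σ t)
rename-subst ρ σ (δ t u v) = cong₃ δ (rename-subst ρ σ t)
  (trans (rename-subst (ext ρ) (exts σ) u) (subst-cong (rename-exts ρ σ) u))
  (trans (rename-subst (ext ρ) (exts σ) v) (subst-cong (rename-exts ρ σ) v))
rename-subst ρ σ (δ⊥ t)    = cong δ⊥ (rename-subst ρ σ t)

subst-exts : ∀ τ σ → subst (exts τ) ∘ exts σ ≗ exts (subst τ ∘ σ)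
subst-exts τ σ zero    = refl
subst-exts τ σ (suc n) =
  trans (subst-rename (exts τ) suc (σ n)) (sym (rename-subst suc τ (σ n)))

subst-∘ : ∀ τ σ → subst τ ∘ subst σ ≗ subst (subst τ ∘ σ)
subst-∘ τ σ (var n)   = refl
subst-∘ τ σ (ƛ t)     =
  cong ƛ (trans (subst-∘ (exts τ) (exts σ) t) (subst-cong (subst-exts τ σ) t))
subst-∘ τ σ (t · u)   = cong₂ _·_ (subst-∘ τ σ t) (subst-∘ τ σ u)
subst-∘ τ σ ⟨ t , u ⟩ = cong₂ ⟨_,_⟩ (subst-∘ τ σ t) (subst-∘ τ σ u)
subst-∘ τ σ (fst t)   = cong fst (subst-∘ τ σ t)
subst-∘ τ σ (snd t)   = cong snd (subst-∘ τ σ t)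
subst-∘ τ σ (inl t)   = cong inl (subst-∘ τ σ t)
subst-∘ τ σ (inr t)   = cong inr (subst-∘ τ σ t)
subst-∘ τ σ (δ t u v) = cong₃ δ (subst-∘ τ σ t)
  (trans (subst-∘ (exts τ) (exts σ) u) (subst-cong (subst-exts τ σ) u))
  (trans (subst-∘ (exts τ) (exts σ) v) (subst-cong (subst-exts τ σ) v))
subst-∘ τ σ (δ⊥ t)    = cong δ⊥ (subst-∘ τ σ t)

exts-var : exts var ≗ var
exts-var zero    = refl
exts-var (suc n) = refl

subst-var : subst var ≗ id
subst-var (var n)   = refl
subst-var (ƛ t)     = cong ƛ (trans (subst-cong exts-var t) (subst-var t))
subst-var (t · u)   = cong₂ _·_ (subst-var t) (subst-var u)
subst-var ⟨ t , u ⟩ = cong₂ ⟨_,_⟩ (subst-var t) (subst-var u)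
subst-var (fst t)   = cong fst (subst-var t)
subst-var (snd t)   = cong snd (subst-var t)
subst-var (inl t)   = cong inl (subst-var t)
subst-var (inr t)   = cong inr (subst-var t)
subst-var (δ t u v) = cong₃ δ (subst-var t)
  (trans (subst-cong exts-var u) (subst-var u))
  (trans (subst-cong exts-var v) (subst-var v))
subst-var (δ⊥ t)    = cong δ⊥ (subst-var t)

infixr 5 _•_

_•_ : Term → (ℕ → Term) → ℕ → Term
(u • σ) zero    = u
(u • σ) (suc n) = σ n

exts-[] : ∀ σ u t → subst (exts σ) t [ u ] ≡ subst (u • σ) t
exts-[] σ u t = trans (subst-∘ (single u) (exts σ) t) (subst-cong single-exts t)
  where
  single-exts : subst (single u) ∘ exts σ ≗ u • σ
  single-exts zero    = refl
  single-exts (suc n) = trans (subst-rename (single u) suc (σ n)) (subst-var (σ n))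

subst-[] : ∀ σ t u → subst σ (t [ u ]) ≡ subst (exts σ) t [ subst σ u ]
subst-[] σ t u = begin
  subst σ (t [ u ])                 ≡⟨ subst-∘ σ (single u) t ⟩
  subst (subst σ ∘ single u) t      ≡⟨ subst-cong single-• t ⟩
  subst (subst σ u • σ) t           ≡⟨ exts-[] σ (subst σ u) t ⟨
  subst (exts σ) t [ subst σ u ]    ∎
  where
  open Eq.≡-Reasoning
  single-• : subst σ ∘ single u ≗ subst σ u • σ
  single-• zero    = refl
  single-• (suc n) = refl

-- Reduction and strong normalisation

▷¹-subst : ∀ σ {t t′} → t ▷¹ t′ → subst σ t ▷¹ subst σ t′
▷¹-subst σ (β-ƛ {t} {u}) rewrite subst-[] σ t u = β-ƛ
▷¹-subst σ β-fst = β-fst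
▷¹-subst σ β-snd = β-snd
▷¹-subst σ (β-inl {t} {u}) rewrite subst-[] σ u t = β-inl
▷¹-subst σ (β-inr {t} {v = v}) rewrite subst-[] σ v t = β-inr
▷¹-subst σ (ξ-ƛ s)   = ξ-ƛ (▷¹-subst (exts σ) s)
▷¹-subst σ (ξ-·ˡ s)  = ξ-·ˡ (▷¹-subst σ s)
▷¹-subst σ (ξ-·ʳ s)  = ξ-·ʳ (▷¹-subst σ s)
▷¹-subst σ (ξ-⟨⟩ˡ s) = ξ-⟨⟩ˡ (▷¹-subst σ s)
▷¹-subst σ (ξ-⟨⟩ʳ s) = ξ-⟨⟩ʳ (▷¹-subst σ s)
▷¹-subst σ (ξ-fst s) = ξ-fst (▷¹-subst σ s)
▷¹-subst σ (ξ-snd s) = ξ-snd (▷¹-subst σ s)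
▷¹-subst σ (ξ-inl s) = ξ-inl (▷¹-subst σ s)
▷¹-subst σ (ξ-inr s) = ξ-inr (▷¹-subst σ s)
▷¹-subst σ (ξ-δ₁ s)  = ξ-δ₁ (▷¹-subst σ s)
▷¹-subst σ (ξ-δ₂ s)  = ξ-δ₂ (▷¹-subst (exts σ) s)
▷¹-subst σ (ξ-δ₃ s)  = ξ-δ₃ (▷¹-subst (exts σ) s)
▷¹-subst σ (ξ-δ⊥ s)  = ξ-δ⊥ (▷¹-subst σ s)

▷-[] : ∀ u {t t′} → t ▷ t′ → t [ u ] ▷ t′ [ u ]
▷-[] u = gmap (_[ u ]) (▷¹-subst (single u))

SN-unsubst : ∀ σ {t} → SN (subst σ t) → SN t
SN-unsubst σ (acc sn) = acc λ s → SN-unsubst σ (sn (▷¹-subst σ s))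

SN-▷ : ∀ {t t′} → SN t → t ▷ t′ → SN t′
SN-▷ sn ε       = sn
SN-▷ sn (s ◅ r) = SN-▷ (acc-inverse sn s) r

SN-ƛ : ∀ {t} → SN t → SN (ƛ t)
SN-ƛ (acc sn) = acc λ { (ξ-ƛ s) → SN-ƛ (sn s) }

SN-inl : ∀ {t} → SN t → SN (inl t)
SN-inl (acc sn) = acc λ { (ξ-inl s) → SN-inl (sn s) }

SN-inr : ∀ {t} → SN t → SN (inr t)
SN-inr (acc sn) = acc λ { (ξ-inr s) → SN-inr (sn s) }

SN-⟨,⟩ : ∀ {t u} → SN t → SN u → SN ⟨ t , u ⟩
SN-⟨,⟩ (acc snt) (acc snu) = acc λ
  { (ξ-⟨⟩ˡ s) → SN-⟨,⟩ (snt s) (acc snu)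
  ; (ξ-⟨⟩ʳ s) → SN-⟨,⟩ (acc snt) (snu s)
  }

ƛ-▷-ƛ : ∀ {t t′} → ƛ t ▷ ƛ t′ → t ▷ t′
ƛ-▷-ƛ ε            = ε
ƛ-▷-ƛ (ξ-ƛ s ◅ r) = s ◅ ƛ-▷-ƛ r

inl-▷-inl : ∀ {t t′} → inl t ▷ inl t′ → t ▷ t′
inl-▷-inl ε              = ε
inl-▷-inl (ξ-inl s ◅ r) = s ◅ inl-▷-inl r

inr-▷-inr : ∀ {t t′} → inr t ▷ inr t′ → t ▷ t′
inr-▷-inr ε              = ε
inr-▷-inr (ξ-inr s ◅ r) = s ◅ inr-▷-inr r

⟨,⟩-▷-⟨,⟩ : ∀ {t u t′ u′} → ⟨ t , u ⟩ ▷ ⟨ t′ , u′ ⟩ → t ▷ t′ × u ▷ u′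
⟨,⟩-▷-⟨,⟩ ε = ε , ε
⟨,⟩-▷-⟨,⟩ (ξ-⟨⟩ˡ s ◅ r) with ⟨,⟩-▷-⟨,⟩ r
... | rt , ru = s ◅ rt , ru
⟨,⟩-▷-⟨,⟩ (ξ-⟨⟩ʳ s ◅ r) with ⟨,⟩-▷-⟨,⟩ r
... | rt , ru = rt , s ◅ ru

inl-⋫-inr : ∀ {t u} → ¬ (inl t ▷ inr u)
inl-⋫-inr (ξ-inl s ◅ r) = inl-⋫-inr r

inr-⋫-inl : ∀ {t u} → ¬ (inr t ▷ inl u)
inr-⋫-inl (ξ-inr s ◅ r) = inr-⋫-inl r

neutral-▷-step : ∀ {t t″} → Neutral t → ¬ Neutral t″ → t ▷ t″ →
                 ∃ λ t′ → t ▷¹ t′ × t′ ▷ t″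
neutral-▷-step nt nt″ ε       = contradiction nt nt″
neutral-▷-step nt nt″ (s ◅ r) = _ , s , r

-- Reducibility

module Reducibility {Atom : Set} (M : PreModel Atom) where

  private
    module Cand P = IsCandidate (PreModel.candidate M P)

  cr₁ : ∀ A → ∣ M ∣ A ⊆ SN
  cr₁ (atom P) = Cand.cr₁ P
  cr₁ ⊥′       = id
  cr₁ (A ⇒ B)  = proj₁
  cr₁ (A ∧ B)  = proj₁
  cr₁ (A ∨ B)  = proj₁

  cr₂ : ∀ A {t t′} → ∣ M ∣ A t → t ▷ t′ → ∣ M ∣ A t′
  cr₂ (atom P) h r                 = Cand.cr₂ P h r
  cr₂ ⊥′ sn r                      = SN-▷ sn r
  cr₂ (A ⇒ B) (sn , ƛ-case) r      = SN-▷ sn r , λ r′ → ƛ-case (r ◅◅ r′)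
  cr₂ (A ∧ B) (sn , ⟨,⟩-case) r    = SN-▷ sn r , λ r′ → ⟨,⟩-case (r ◅◅ r′)
  cr₂ (A ∨ B) (sn , inl-case , inr-case) r =
    SN-▷ sn r , (λ r′ → inl-case (r ◅◅ r′)) , (λ r′ → inr-case (r ◅◅ r′))

  -- A neutral term reaches an introduction form only after a first step,
  -- whose target is reducible by hypothesis.
  cr₃ : ∀ A {t} → Neutral t → (∀ {t′} → t ▷¹ t′ → ∣ M ∣ A t′) → ∣ M ∣ A t
  cr₃ (atom P) nt h = Cand.cr₃ P nt h
  cr₃ ⊥′ nt h       = acc h
  cr₃ (A ⇒ B) nt h  = acc (cr₁ (A ⇒ B) ∘ h) , λ r u hu →
    let _ , s , r′ = neutral-▷-step nt (λ ()) r in proj₂ (h s) r′ u hu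
  cr₃ (A ∧ B) nt h  = acc (cr₁ (A ∧ B) ∘ h) , λ r →
    let _ , s , r′ = neutral-▷-step nt (λ ()) r in proj₂ (h s) r′
  cr₃ (A ∨ B) nt h  = acc (cr₁ (A ∨ B) ∘ h) ,
    (λ r → let _ , s , r′ = neutral-▷-step nt (λ ()) r in proj₁ (proj₂ (h s)) r′) ,
    (λ r → let _ , s , r′ = neutral-▷-step nt (λ ()) r in proj₂ (proj₂ (h s)) r′)

  var-reducible : ∀ A {n} → ∣ M ∣ A (var n)
  var-reducible A = cr₃ A var (λ ())

  ⇒-antitoneˡ : ∀ A A′ B → ∣ M ∣ A′ ⊆ ∣ M ∣ A → ∣ M ∣ (A ⇒ B) ⊆ ∣ M ∣ (A′ ⇒ B)
  ⇒-antitoneˡ _ _ B A′⊆A (sn , ƛ-case) = sn , λ r u hu → ƛ-case r u (A′⊆A hu)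

  ⇒-monoʳ : ∀ A B B′ → ∣ M ∣ B ⊆ ∣ M ∣ B′ → ∣ M ∣ (A ⇒ B) ⊆ ∣ M ∣ (A ⇒ B′)
  ⇒-monoʳ A _ _ B⊆B′ (sn , ƛ-case) = sn , λ r u hu → B⊆B′ (ƛ-case r u hu)

  ∧-monoˡ : ∀ A A′ B → ∣ M ∣ A ⊆ ∣ M ∣ A′ → ∣ M ∣ (A ∧ B) ⊆ ∣ M ∣ (A′ ∧ B)
  ∧-monoˡ _ _ B A⊆A′ (sn , ⟨,⟩-case) =
    sn , λ r → let ht , hu = ⟨,⟩-case r in A⊆A′ ht , hu

  ∧-monoʳ : ∀ A B B′ → ∣ M ∣ B ⊆ ∣ M ∣ B′ → ∣ M ∣ (A ∧ B) ⊆ ∣ M ∣ (A ∧ B′)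
  ∧-monoʳ A _ _ B⊆B′ (sn , ⟨,⟩-case) =
    sn , λ r → let ht , hu = ⟨,⟩-case r in ht , B⊆B′ hu

  ∨-monoˡ : ∀ A A′ B → ∣ M ∣ A ⊆ ∣ M ∣ A′ → ∣ M ∣ (A ∨ B) ⊆ ∣ M ∣ (A′ ∨ B)
  ∨-monoˡ _ _ B A⊆A′ (sn , inl-case , inr-case) = sn , A⊆A′ ∘ inl-case , inr-case

  ∨-monoʳ : ∀ A B B′ → ∣ M ∣ B ⊆ ∣ M ∣ B′ → ∣ M ∣ (A ∨ B) ⊆ ∣ M ∣ (A ∨ B′)
  ∨-monoʳ A _ _ B⊆B′ (sn , inl-case , inr-case) = sn , inl-case , B⊆B′ ∘ inr-case

  ReducibleBody : Prop Atom → Prop Atom → Term → Set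
  ReducibleBody A C t = ∀ u → ∣ M ∣ A u → ∣ M ∣ C (t [ u ])

  ReducibleBody-▷¹ : ∀ A C {t t′} → ReducibleBody A C t → t ▷¹ t′ → ReducibleBody A C t′
  ReducibleBody-▷¹ A C f s u hu = cr₂ C (f u hu) (▷¹-subst (single u) s ◅ ε)

  body-SN : ∀ A C {t} → ReducibleBody A C t → SN t
  body-SN A C f = SN-unsubst (single (var zero)) (cr₁ C (f (var zero) (var-reducible A)))

  ƛ-reducible : ∀ A B {t} → ReducibleBody A B t → ∣ M ∣ (A ⇒ B) (ƛ t)
  ƛ-reducible A B f =
    SN-ƛ (body-SN A B f) , λ r u hu → cr₂ B (f u hu) (▷-[] u (ƛ-▷-ƛ r))

  ⟨,⟩-reducible : ∀ A B {t u} → ∣ M ∣ A t → ∣ M ∣ B u → ∣ M ∣ (A ∧ B) ⟨ t , u ⟩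
  ⟨,⟩-reducible A B ht hu = SN-⟨,⟩ (cr₁ A ht) (cr₁ B hu) , λ r →
    let rt , ru = ⟨,⟩-▷-⟨,⟩ r in cr₂ A ht rt , cr₂ B hu ru

  inl-reducible : ∀ A B {t} → ∣ M ∣ A t → ∣ M ∣ (A ∨ B) (inl t)
  inl-reducible A B ht =
    SN-inl (cr₁ A ht) , cr₂ A ht ∘ inl-▷-inl , λ r → contradiction r inl-⋫-inr

  inr-reducible : ∀ A B {t} → ∣ M ∣ B t → ∣ M ∣ (A ∨ B) (inr t)
  inr-reducible A B ht =
    SN-inr (cr₁ B ht) , (λ r → contradiction r inr-⋫-inl) , cr₂ B ht ∘ inr-▷-inr

  -- The elimination lemmas go by induction on the strong normalisability of
  -- the immediate subterms; cr₃ applies because eliminations are neutral.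

  ·-reducible : ∀ A B {t u} → ∣ M ∣ (A ⇒ B) t → ∣ M ∣ A u → ∣ M ∣ B (t · u)
  ·-reducible A B ht hu = go (cr₁ (A ⇒ B) ht) (cr₁ A hu) ht hu
    where
    go : ∀ {t u} → SN t → SN u → ∣ M ∣ (A ⇒ B) t → ∣ M ∣ A u → ∣ M ∣ B (t · u)
    go {u = u} (acc snt) (acc snu) ht hu = cr₃ B app λ where
      β-ƛ      → proj₂ ht ε u hu
      (ξ-·ˡ s) → go (snt s) (acc snu) (cr₂ (A ⇒ B) ht (s ◅ ε)) hu
      (ξ-·ʳ s) → go (acc snt) (snu s) ht (cr₂ A hu (s ◅ ε))

  fst-reducible : ∀ A B {t} → ∣ M ∣ (A ∧ B) t → ∣ M ∣ A (fst t)
  fst-reducible A B ht = go (cr₁ (A ∧ B) ht) ht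
    where
    go : ∀ {t} → SN t → ∣ M ∣ (A ∧ B) t → ∣ M ∣ A (fst t)
    go (acc snt) ht = cr₃ A fst λ where
      β-fst     → proj₁ (proj₂ ht ε)
      (ξ-fst s) → go (snt s) (cr₂ (A ∧ B) ht (s ◅ ε))

  snd-reducible : ∀ A B {t} → ∣ M ∣ (A ∧ B) t → ∣ M ∣ B (snd t)
  snd-reducible A B ht = go (cr₁ (A ∧ B) ht) ht
    where
    go : ∀ {t} → SN t → ∣ M ∣ (A ∧ B) t → ∣ M ∣ B (snd t)
    go (acc snt) ht = cr₃ B snd λ where
      β-snd     → proj₂ (proj₂ ht ε)
      (ξ-snd s) → go (snt s) (cr₂ (A ∧ B) ht (s ◅ ε))

  δ⊥-reducible : ∀ A {t} → SN t → ∣ M ∣ A (δ⊥ t)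
  δ⊥-reducible A (acc snt) = cr₃ A δ⊥ λ where
    (ξ-δ⊥ s) → δ⊥-reducible A (snt s)

  δ-reducible : ∀ A B C {t u v} → ∣ M ∣ (A ∨ B) t →
                ReducibleBody A C u → ReducibleBody B C v → ∣ M ∣ C (δ t u v)
  δ-reducible A B C ht fu fv =
    go (cr₁ (A ∨ B) ht) (body-SN A C fu) (body-SN B C fv) ht fu fv
    where
    go : ∀ {t u v} → SN t → SN u → SN v → ∣ M ∣ (A ∨ B) t →
         ReducibleBody A C u → ReducibleBody B C v → ∣ M ∣ C (δ t u v)
    go snt@(acc snt′) snu@(acc snu′) snv@(acc snv′) ht fu fv = cr₃ C δ λ where
      β-inl     → fu _ (proj₁ (proj₂ ht) ε)
      β-inr     → fv _ (proj₂ (proj₂ ht) ε)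
      (ξ-δ₁ s) → go (snt′ s) snu snv (cr₂ (A ∨ B) ht (s ◅ ε)) fu fv
      (ξ-δ₂ s) → go snt (snu′ s) snv ht (ReducibleBody-▷¹ A C fu s) fv
      (ξ-δ₃ s) → go snt snu (snv′ s) ht fu (ReducibleBody-▷¹ B C fv s)

  infix 4 _⊨_

  _⊨_ : (ℕ → Term) → List (Prop Atom) → Set
  σ ⊨ Γ = ∀ {n B} → Γ ∋ n ∶ B → ∣ M ∣ B (σ n)

  var-⊨ : ∀ {Γ} → var ⊨ Γ
  var-⊨ {B = B} _ = var-reducible B

  •-⊨ : ∀ {Γ A σ u} → ∣ M ∣ A u → σ ⊨ Γ → u • σ ⊨ A ∷ Γ
  •-⊨ hu σ⊨Γ here      = hu
  •-⊨ hu σ⊨Γ (there x) = σ⊨Γ x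

-- Adequacy

module Adequacy {Atom : Set} (R : PRS Atom) (M : PreModel Atom)
                (isPreModel : IsPreModelOf R M) where

  open Reducibility M

  Mono : Sign → Prop Atom → Prop Atom → Set
  Mono neg A B = ∣ M ∣ A ⊆ ∣ M ∣ B
  Mono pos A B = ∣ M ∣ B ⊆ ∣ M ∣ A

  Step-mono : ∀ {s A B} → Step R s A B → Mono s A B
  Step-mono (rule₋ r)                  = proj₁ isPreModel r _
  Step-mono (rule₊ r)                  = proj₂ isPreModel r _
  Step-mono (⇒ˡ {neg} {A} {A′} {B} s) = ⇒-antitoneˡ A A′ B (Step-mono s)
  Step-mono (⇒ˡ {pos} {A} {A′} {B} s) = ⇒-antitoneˡ A′ A B (Step-mono s)
  Step-mono (⇒ʳ {neg} {A} {B} {B′} s) = ⇒-monoʳ A B B′ (Step-mono s)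
  Step-mono (⇒ʳ {pos} {A} {B} {B′} s) = ⇒-monoʳ A B′ B (Step-mono s)
  Step-mono (∧ˡ {neg} {A} {A′} {B} s) = ∧-monoˡ A A′ B (Step-mono s)
  Step-mono (∧ˡ {pos} {A} {A′} {B} s) = ∧-monoˡ A′ A B (Step-mono s)
  Step-mono (∧ʳ {neg} {A} {B} {B′} s) = ∧-monoʳ A B B′ (Step-mono s)
  Step-mono (∧ʳ {pos} {A} {B} {B′} s) = ∧-monoʳ A B′ B (Step-mono s)
  Step-mono (∨ˡ {neg} {A} {A′} {B} s) = ∨-monoˡ A A′ B (Step-mono s)
  Step-mono (∨ˡ {pos} {A} {A′} {B} s) = ∨-monoˡ A′ A B (Step-mono s)
  Step-mono (∨ʳ {neg} {A} {B} {B′} s) = ∨-monoʳ A B B′ (Step-mono s)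
  Step-mono (∨ʳ {pos} {A} {B} {B′} s) = ∨-monoʳ A B′ B (Step-mono s)

  ⟶₋-mono : ∀ {A B} → Rewrite R neg A B → ∣ M ∣ A ⊆ ∣ M ∣ B
  ⟶₋-mono ε       = id
  ⟶₋-mono (s ◅ r) = ⟶₋-mono r ∘ Step-mono s

  ⟶₊-antitone : ∀ {A B} → Rewrite R pos A B → ∣ M ∣ B ⊆ ∣ M ∣ A
  ⟶₊-antitone ε       = id
  ⟶₊-antitone (s ◅ r) = Step-mono s ∘ ⟶₊-antitone r

  mutual
    adequacy : ∀ {Γ π A σ} → Γ ⊢[ R ] π ∶ A → σ ⊨ Γ → ∣ M ∣ A (subst σ π)
    adequacy (ax x B⟶C A⟶C) σ⊨Γ = ⟶₊-antitone A⟶C (⟶₋-mono B⟶C (σ⊨Γ x))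
    adequacy (⇒I {A = A} {B} ⊢π C⟶A⇒B) σ⊨Γ =
      ⟶₊-antitone C⟶A⇒B (ƛ-reducible A B (adequacy-body ⊢π σ⊨Γ))
    adequacy (⇒E {A = A} {B} ⊢π₁ C⟶A⇒B ⊢π₂) σ⊨Γ =
      ·-reducible A B (⟶₋-mono C⟶A⇒B (adequacy ⊢π₁ σ⊨Γ)) (adequacy ⊢π₂ σ⊨Γ)
    adequacy (∧I {A = A} {B} ⊢π₁ ⊢π₂ C⟶A∧B) σ⊨Γ =
      ⟶₊-antitone C⟶A∧B (⟨,⟩-reducible A B (adequacy ⊢π₁ σ⊨Γ) (adequacy ⊢π₂ σ⊨Γ))
    adequacy (∧E₁ {A = A} {B} ⊢π C⟶A∧B) σ⊨Γ =
      fst-reducible A B (⟶₋-mono C⟶A∧B (adequacy ⊢π σ⊨Γ))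
    adequacy (∧E₂ {A = A} {B} ⊢π C⟶A∧B) σ⊨Γ =
      snd-reducible A B (⟶₋-mono C⟶A∧B (adequacy ⊢π σ⊨Γ))
    adequacy (∨I₁ {A = A} {B} ⊢π C⟶A∨B) σ⊨Γ =
      ⟶₊-antitone C⟶A∨B (inl-reducible A B (adequacy ⊢π σ⊨Γ))
    adequacy (∨I₂ {A = A} {B} ⊢π C⟶A∨B) σ⊨Γ =
      ⟶₊-antitone C⟶A∨B (inr-reducible A B (adequacy ⊢π σ⊨Γ))
    adequacy (∨E {A = A} {B} {C} ⊢π₁ D⟶A∨B ⊢π₂ ⊢π₃) σ⊨Γ =
      δ-reducible A B C (⟶₋-mono D⟶A∨B (adequacy ⊢π₁ σ⊨Γ))
        (adequacy-body ⊢π₂ σ⊨Γ) (adequacy-body ⊢π₃ σ⊨Γ)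
    adequacy (⊥E {A = A} ⊢π B⟶⊥) σ⊨Γ =
      δ⊥-reducible A (cr₁ ⊥′ (⟶₋-mono B⟶⊥ (adequacy ⊢π σ⊨Γ)))

    adequacy-body : ∀ {Γ π A C σ} → (A ∷ Γ) ⊢[ R ] π ∶ C → σ ⊨ Γ →
                    ReducibleBody A C (subst (exts σ) π)
    adequacy-body {π = π} {σ = σ} ⊢π σ⊨Γ u hu
      rewrite exts-[] σ u π = adequacy ⊢π (•-⊨ hu σ⊨Γ)

corollary1 : {Atom : Set} (R : PRS Atom) → Commute R →
             (M : PreModel Atom) → IsPreModelOf R M →
             (Γ : List (Prop Atom)) (π : Term) (A : Prop Atom) →
             Γ ⊢[ R ] π ∶ A → ∣ M ∣ A π × SN π
corollary1 R _ M isPreModel Γ π A ⊢π = π-reducible , cr₁ A π-reducible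
  where
  open Reducibility M
  open Adequacy R M isPreModel

  π-reducible : ∣ M ∣ A π
  π-reducible = Eq.subst (∣ M ∣ A) (subst-var π) (adequacy ⊢π var-⊨)
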